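{- Let $n\geq 1$. For any $\mu,\mu'\in\mathsf{BP}_n$, we have $\mu\equiv_\star\mu'$ if and only if for every automata network $f:X\to X$ of size $n$ (that is, for every choice of finite non-empty alphabets $X_0,\dots,X_{n-1}$, with $X=\prod_{i\in\llbracket n\rrbracket}X_i$, and every function $f:X\to X$), $f^{\Omega}_{\{\mu\}}\sim f^{\Omega}_{\{\mu'\}}$.
   Context: Notation: $\llbracket n\rrbracket=\{0,\dots,n-1\}$. A partitioned order of $\llbracket n\rrbracket$ is an (unordered) set $\{S_k\}_{k\in\llbracket s\rrbracket}$ of $s$ sequences $S_k=(i^k_0,\dots,i^k_{n_k-1})$ with $n_k>0$, each consisting of pairwise distinct elements of $\llbracket n\rrbracket$, the sequences being pairwise disjoint (as sets of entries) with union $\llbracket n\rrbracket$. $\mathsf{BP}_n$ is the set of all partitioned orders of $\llbracket n\rrbracket$ (block-parallel update modes of size $n$). For $\mu=\{S_k\}_{k\in\llbracket s\rrbracket}\in\mathsf{BP}_n$, let $p=\mathrm{lcm}(n_0,\dots,n_{s-1})$ and define the sequence of blocks $\varphi(\mu)=(W_\ell)_{\ell\in\llbracket p\rrbracket}$ by $W_\ell=\{i^k_{\ell \bmod n_k}\mid k\in\llbracket s\rrbracket\}$; write $|\varphi(\mu)|=p$. $\sigma^i$ denotes the circular shift of order $i\in\mathbb{Z}$ on finite sequences, moving the element at position $0$ to position $i$ (positions modulo the length). For $\mu,\mu'\in\mathsf{BP}_n$, $\mu\equiv_\star\mu'$ means $\varphi(\mu)=\sigma^i(\varphi(\mu'))$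 for some $i\in\llbracket|\varphi(\mu')|\rrbracket$. Automata networks: an automata network of size $n$ is a function $f:X\to X$ with $X=\prod_{i\in\llbracket n\rrbracket}X_i$, each $X_i$ being a finite alphabet; $f_i:X\to X_i$ is the $i$-th component of $f$. For $W\subseteq\llbracket n\rrbracket$, $f_{(W)}:X\to X$ is defined by $f_{(W)}(x)_i=f_i(x)$ if $i\in W$ and $f_{(W)}(x)_i=x_i$ otherwise. For $\mu\in\mathsf{BP}_n$ with $\varphi(\mu)=(W_0,\dots,W_{p-1})$, the update of $f$ under $\mu$ is $f_{\{\mu\}}=f_{(W_{p-1})}\circ\dots\circ f_{(W_1)}\circ f_{(W_0)}$. Limit dynamics: the limit set of $f_{\{\mu\}}$ is $\Omega_{f_{\{\mu\}}}=\bigcap_{t\in\mathbb{N}} (f_{\{\mu\}})^t(X)$ (iterated images), and $f^{\Omega}_{\{\mu\}}:\Omega_{f_{\{\mu\}}}\to\Omega_{f_{\{\mu\}}}$ is the restriction of $f_{\{\mu\}}$ to its limit set. For two such maps $g:A\to A$, $h:B\to B$, $g\sim h$ means that their functional digraphs (vertex set $A$ with arcs $(x,g(x))$, resp. vertex set $B$ with arcs $(y,h(y))$) are isomorphic, i.e. there is a bijection $\pi:A\to B$ with $g(x)=y\iff h(\pi(x))=\pi(y)$ for all $x,y\in A$. -}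

module Defs where

open import Data.Bool.Base using (if_then_else_)
open import Data.Fin.Base using (Fin; toℕ)
open import Data.Fin.Subset using (Subset; ⁅_⁆; ⋃)
open import Data.Fin.Subset.Properties using (_∈?_)
open import Data.Integer.Base using (ℤ; +_; -_; _%ℕ_)
open import Data.List.Base as List
  using (List; []; _∷_; _++_; map; take; drop; foldr; foldl; upTo)
open import Data.List.Membership.Propositional using (_∈_)
open import Data.List.NonEmpty.Base as List⁺ using (List⁺; toList)
open import Data.List.Relation.Binary.Disjoint.Propositional using (Disjoint)
open import Data.List.Relation.Unary.All using (All)
open import Data.List.Relation.Unary.AllPairs using (AllPairs)
open import Data.List.Relation.Unary.Any using (Any)
open import Data.List.Relation.Unary.Unique.Propositional using (Unique)
open import Data.Nat.Base using (ℕ; zero; suc)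
open import Data.Nat.DivMod using (_mod_)
open import Data.Nat.LCM using (lcm)
open import Data.Product.Base using (Σ; ∃-syntax; _,_; proj₁)
open import Function.Bundles using (Func; Bijection; _↔_; _⇔_; _⟶ₛ_; _⟨$⟩_)
open import Function.Construct.Composition using (function)
open import Function.Construct.Identity using () renaming (function to identity)
import Function.Endo.Setoid as Endo
open import Level using (Level; 0ℓ; _⊔_)
open import Relation.Binary.Bundles using (Setoid)
import Relation.Binary.Construct.On as On
open import Relation.Binary.PropositionalEquality.Core
  using (_≡_; refl; sym; trans)
open import Relation.Nullary.Decidable.Core using (does; yes; no)

private
  variable
    n : ℕ
    a b ℓ₁ ℓ₂ : Level

-- The set of sequences is given by an enumeration.  It has no
-- repetitions, because the sequences are nonempty and pairwise disjoint;
-- its order has no influence on φ.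

record BP (n : ℕ) : Set where
  field
    sequences : List (List⁺ (Fin n))
    distinct  : All (λ S → Unique (toList S)) sequences
    disjoint  : AllPairs (λ S T → Disjoint (toList S) (toList T)) sequences
    covering  : ∀ i → Any (λ S → i ∈ toList S) sequences

period : BP n → ℕ
period μ = foldr lcm 1 (map List⁺.length (BP.sequences μ))

entry : List⁺ (Fin n) → ℕ → Fin n
entry S ℓ = List.lookup (toList S) (ℓ mod List⁺.length S)

block : BP n → ℕ → Subset n
block μ ℓ = ⋃ (map (λ S → ⁅ entry S ℓ ⁆) (BP.sequences μ))

φ : BP n → List (Subset n)
φ μ = map (block μ) (upTo (period μ))

-- The element at position 0 moves to position i (modulo the length), so
-- the new first element is the one at position - i.

σ : {A : Set a} → ℤ → List A → List A
σ i []          = []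
σ i xs@(_ ∷ _) = drop k xs ++ take k xs
  where k = (- i) %ℕ List.length xs

infix 4 _≡⋆_

_≡⋆_ : BP n → BP n → Set
μ ≡⋆ μ′ = ∃[ i ] φ μ ≡ σ (+ toℕ {List.length (φ μ′)} i) (φ μ′)

-- Configurations are dependent functions compared pointwise; since
-- function extensionality is not available, a map between them is
-- required to respect pointwise equality.

Configuration : (Fin n → Set) → Setoid 0ℓ 0ℓ
Configuration X = record
  { Carrier       = ∀ i → X i
  ; _≈_           = λ x y → ∀ i → x i ≡ y i
  ; isEquivalence = record
    { refl  = λ _ → refl
    ; sym   = λ x≈y i → sym (x≈y i)
    ; trans = λ x≈y y≈z i → trans (x≈y i) (y≈z i)
    }
  }

record AutomataNetwork (n : ℕ) : Set₁ where
  field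
    Alphabet   : Fin n → Set
    finite     : ∀ i → ∃[ q ] (Alphabet i ↔ Fin q)
    nonempty   : ∀ i → Alphabet i
    transition : Configuration Alphabet ⟶ₛ Configuration Alphabet

  X : Setoid 0ℓ 0ℓ
  X = Configuration Alphabet

  updateBlock : Subset n → X ⟶ₛ X
  updateBlock W = record
    { to   = λ x i → if does (i ∈? W) then (transition ⟨$⟩ x) i else x i
    ; cong = λ x≈y i → cong′ x≈y i
    }
    where
    cong′ : ∀ {x y} → (∀ i → x i ≡ y i) → ∀ i →
            (if does (i ∈? W) then (transition ⟨$⟩ x) i else x i) ≡
            (if does (i ∈? W) then (transition ⟨$⟩ y) i else y i)
    cong′ x≈y i with i ∈? W
    ... | yes _ = Func.cong transition x≈y i
    ... | no  _ = x≈y i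

  -- `function g h` applies g first, then h.

  update : BP n → X ⟶ₛ X
  update μ = foldl (λ g W → function g (updateBlock W)) (identity X) (φ μ)

module Limit {S : Setoid a ℓ₁} (g : S ⟶ₛ S) where
  open Setoid S using (_≈_; Carrier)
    renaming (refl to ≈-refl; trans to ≈-trans)
  open Endo S using (_^_)

  InLimit : Carrier → Set (a ⊔ ℓ₁)
  InLimit x = ∀ t → ∃[ y ] ((g ^ t) ⟨$⟩ y) ≈ x

  Ω : Setoid (a ⊔ ℓ₁) ℓ₁
  Ω = On.setoid {B = Σ Carrier InLimit} S proj₁

  private
    ^-comm : ∀ t y → ((g ^ t) ⟨$⟩ (g ⟨$⟩ y)) ≈ (g ⟨$⟩ ((g ^ t) ⟨$⟩ y))
    ^-comm zero    y = ≈-refl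
    ^-comm (suc t) y = ^-comm t (g ⟨$⟩ y)

  restriction : Ω ⟶ₛ Ω
  restriction = record
    { to   = λ (x , x∈Ω) → g ⟨$⟩ x , λ t →
        let (y , gᵗy≈x) = x∈Ω t in
        g ⟨$⟩ y , ≈-trans (^-comm t y) (Func.cong g gᵗy≈x)
    ; cong = Func.cong g
    }

infix 4 _∼_

_∼_ : {A : Setoid a ℓ₁} {B : Setoid b ℓ₂} → A ⟶ₛ A → B ⟶ₛ B →
      Set (a ⊔ b ⊔ ℓ₁ ⊔ ℓ₂)
_∼_ {A = A} {B = B} g h =
  Σ (Bijection A B) λ π → let open Bijection π using (to) in
    ∀ x y → ((g ⟨$⟩ x) A.≈ y) ⇔ ((h ⟨$⟩ to x) B.≈ to y)
  where
  module A = Setoid A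
  module B = Setoid B

limitUpdate : (f : AutomataNetwork n) (μ : BP n) →
              let open Limit (AutomataNetwork.update f μ) in Ω ⟶ₛ Ω
limitUpdate f μ = Limit.restriction (AutomataNetwork.update f μ)

{-# OPTIONS --safe #-}

-- If the sequence of blocks of μ is U V and that of μ′ is V U, then the
-- updates are B ∘ A and A ∘ B, and A restricts to a conjugacy between
-- their limit dynamics: on a finite set the limit points are the
-- periodic points, so both composites are bijective there.
--
-- Conversely, a single network attached to μ tells μ apart from every
-- inequivalent mode.  Every block contains exactly one element of each
-- sequence S of μ.  Automata count their own updates modulo M, so that
-- the sum over S of the counters is the current time; the network is
-- able to read this time off, and writes an error at any automaton that
-- is updated although the block of μ at that time does not contain it.
-- If an expected update is missing, the sums over two sequences
-- differ, and this is treated as an error too.  Errors spread to all of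
-- the network.  Hence under μ′ a limit configuration other than the
-- all-error one exists only if the blocks of μ′ are those of μ read from
-- some time on.  Such a configuration does exist under μ.

module Submission where

open import Defs
open import Data.Bool.Base using (if_then_else_)
open import Data.Fin.Base using (Fin; zero; suc; toℕ; fromℕ<; combine)
import Data.Fin.Properties as Fin
open import Data.Fin.Subset using (Subset; ⁅_⁆; ⋃)
  renaming (_∈_ to _∈ˢ_; _∉_ to _∉ˢ_; _⊆_ to _⊆ˢ_)
import Data.Fin.Subset.Properties as Subset
open import Data.Integer.Base as ℤ using (ℤ; -_; -[1+_]; _%ℕ_)
open import Data.List.Base as List
  using (List; []; _∷_; _++_; take; drop; length; map; upTo; applyUpTo; foldr; foldl)
open import Data.List.Membership.Propositional using (_∈_; find)
open import Data.List.Membership.Propositional.Properties using (∈-lookup; ∈-AllPairs₂)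
open import Data.List.NonEmpty.Base as List⁺ using (List⁺; toList)
open import Data.List.Properties
open import Data.List.Relation.Unary.All as All using (All)
open import Data.List.Relation.Unary.AllPairs using (_∷_)
open import Data.List.Relation.Unary.Any as Any using (Any; here; there)
open import Data.List.Relation.Unary.Any.Properties using (lookup-index; map⁺; map⁻)
open import Data.List.Relation.Unary.Unique.Propositional using (Unique)
open import Data.Nat.Base hiding (_^_)
open import Data.Nat.Divisibility
open import Data.Nat.DivMod
open import Data.Nat.GCD using (gcd)
open import Data.Nat.LCM using (lcm; m∣lcm[m,n]; n∣lcm[m,n]; lcm-least; gcd*lcm)
open import Data.Nat.ListAction using (sum)
open import Data.Nat.Properties
open import Data.Product.Base using (Σ; ∃-syntax; _×_; _,_; proj₁; proj₂)
open import Data.Sum.Base using (inj₁; inj₂; [_,_]′)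
open import Function.Base using (_∘_; id)
open import Function.Bundles
open import Function.Construct.Composition using (function)
open import Function.Construct.Identity using (↔-id)
import Function.Endo.Setoid as Endo
open import Function.Properties.Inverse using (↔⇒↣)
open import Level using (Level)
open import Relation.Binary.Bundles using (Setoid)
open import Relation.Binary.PropositionalEquality as ≡
  using (_≡_; _≢_; _≗_; refl; sym; trans; cong; cong₂; subst)
import Relation.Binary.Reasoning.Setoid as ≈-Reasoning
open import Relation.Nullary.Decidable
  using (Dec; yes; no; does; ¬?; _×-dec_; dec-true; dec-false; decidable-stable; toSum)
open import Relation.Nullary.Negation.Core using (¬_; contradiction)

private
  variable
    n : ℕ
    a c ℓ : Level
    A : Set a

-- Limit dynamics of finite maps

-- Finiteness in the form that the pigeonhole principle consumes, stated up to `_≈_` to suit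
-- configurations compared pointwise.
Encoding : Setoid c ℓ → Set _
Encoding S = ∃[ N ] Σ (Carrier → Fin N) λ encode → ∀ x y → encode x ≡ encode y → x ≈ y
  where open Setoid S

module LimitProperties {S : Setoid c ℓ} (g : S ⟶ₛ S) where
  open Setoid S using (_≈_; Carrier)
    renaming (refl to ≈-refl; sym to ≈-sym; trans to ≈-trans; reflexive to ≈-reflexive)
  open Endo S using (_^_)
  open Limit g

  IsPeriodic : Carrier → Set ℓ
  IsPeriodic x = ∃[ q ] ((g ^ suc q) ⟨$⟩ x) ≈ x

  ^-+ : ∀ s t x → ((g ^ (s + t)) ⟨$⟩ x) ≈ ((g ^ s) ⟨$⟩ ((g ^ t) ⟨$⟩ x))
  ^-+ s t x = ≈-trans (≈-reflexive (cong (λ r → (g ^ r) ⟨$⟩ x) (+-comm s t))) (go t x)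
    where
    go : ∀ t x → ((g ^ (t + s)) ⟨$⟩ x) ≈ ((g ^ s) ⟨$⟩ ((g ^ t) ⟨$⟩ x))
    go zero    x = ≈-refl
    go (suc t) x = go t (g ⟨$⟩ x)

  ^-*-fixed : ∀ q {x} → ((g ^ q) ⟨$⟩ x) ≈ x → ∀ k → ((g ^ (k * q)) ⟨$⟩ x) ≈ x
  ^-*-fixed q fix zero = ≈-refl
  ^-*-fixed q {x} fix (suc k) =
    ≈-trans (^-+ q (k * q) x) (≈-trans (Func.cong (g ^ q) (^-*-fixed q fix k)) fix)

  -- The `t`-fold preimage is found on the cycle itself: `t * q` steps followed by `t` more make `t`
  -- rounds of length `suc q`.
  periodic⇒limit : ∀ {x} → IsPeriodic x → InLimit x
  periodic⇒limit {x} (q , fix) t = ((g ^ (t * q)) ⟨$⟩ x) ,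
    ≈-trans (≈-sym (^-+ t (t * q) x))
      (≈-trans (≈-reflexive (cong (λ s → (g ^ s) ⟨$⟩ x) (sym (*-suc t q)))) (^-*-fixed (suc q) fix t))

  module _ (enc : Encoding S) where
    private
      N = proj₁ enc
      encode = proj₁ (proj₂ enc)
      encode-injective = proj₂ (proj₂ enc)

    -- Two of the first `N + 1` iterates share a code. The bound on `i` lets `limit⇒periodic` fix
    -- the depth of a preimage in advance.
    iterate-periodic : ∀ y → ∃[ i ] i ≤ N × IsPeriodic ((g ^ i) ⟨$⟩ y)
    iterate-periodic y
      with i , j , i<j , eq ← Fin.pigeonhole (n<1+n N) (λ k → encode ((g ^ toℕ k) ⟨$⟩ y))
      with d , 1+i+d≡j ← m≤n⇒∃[o]m+o≡n i<j
      = toℕ i , Fin.toℕ≤pred[n] i , d ,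
        ≈-trans (≈-sym (^-+ (suc d) (toℕ i) y))
          (≈-trans (≈-reflexive (cong (λ s → (g ^ s) ⟨$⟩ y) (trans (cong suc (+-comm d (toℕ i))) 1+i+d≡j)))
            (≈-sym (encode-injective _ _ eq)))

    -- A preimage of `x` under `N` steps reaches a periodic point within these steps, and `x` lies
    -- further along the same cycle.
    limit⇒periodic : ∀ {x} → InLimit x → IsPeriodic x
    limit⇒periodic {x} x∈Ω
      with y , gᴺy≈x ← x∈Ω N
      with i , i≤N , q , fix ← iterate-periodic y
      with d , i+d≡N ← m≤n⇒∃[o]m+o≡n i≤N
      = q , (begin
        (g ^ suc q) ⟨$⟩ x                              ≈⟨ Func.cong (g ^ suc q) x≈ ⟩
        (g ^ suc q) ⟨$⟩ ((g ^ d) ⟨$⟩ z)                ≈⟨ ^-+ (suc q) d z ⟨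
        (g ^ (suc q + d)) ⟨$⟩ z                        ≡⟨ cong (λ s → (g ^ s) ⟨$⟩ z) (+-comm (suc q) d) ⟩
        (g ^ (d + suc q)) ⟨$⟩ z                        ≈⟨ ^-+ d (suc q) z ⟩
        (g ^ d) ⟨$⟩ ((g ^ suc q) ⟨$⟩ z)                ≈⟨ Func.cong (g ^ d) fix ⟩
        (g ^ d) ⟨$⟩ z                                  ≈⟨ x≈ ⟨
        x                                              ∎)
      where
      open ≈-Reasoning S
      z = (g ^ i) ⟨$⟩ y
      x≈ : x ≈ ((g ^ d) ⟨$⟩ z)
      x≈ = ≈-trans (≈-sym gᴺy≈x)
        (≈-trans (≈-reflexive (cong (λ s → (g ^ s) ⟨$⟩ y) (trans (sym i+d≡N) (+-comm i d))))
          (^-+ d i y))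

module _ {S : Setoid c ℓ} (enc : Encoding S) (g h A B : S ⟶ₛ S) where
  open Setoid S using (_≈_; Carrier)
    renaming (refl to ≈-refl; sym to ≈-sym; trans to ≈-trans; reflexive to ≈-reflexive)
  open Endo S using (_^_)
  private
    module G = LimitProperties g
    module H = LimitProperties h

  commute-limit-∼ : (∀ x → (g ⟨$⟩ x) ≈ (B ⟨$⟩ (A ⟨$⟩ x))) →
                    (∀ x → (h ⟨$⟩ x) ≈ (A ⟨$⟩ (B ⟨$⟩ x))) →
                    Limit.restriction g ∼ Limit.restriction h
  commute-limit-∼ g≈BA h≈AB = π , λ (x , x∈) (y , y∈) → mk⇔
    (λ gx≈y → ≈-trans (≈-sym (Ag≈hA x)) (Func.cong A gx≈y))
    (λ hAx≈Ay → A-injective (proj₂ (Func.to (Limit.restriction g) (x , x∈))) y∈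
                  (≈-trans (Ag≈hA x) hAx≈Ay))
    where
    open ≈-Reasoning S

    Ag≈hA : ∀ x → (A ⟨$⟩ (g ⟨$⟩ x)) ≈ (h ⟨$⟩ (A ⟨$⟩ x))
    Ag≈hA x = ≈-trans (Func.cong A (g≈BA x)) (≈-sym (h≈AB _))

    Bh≈gB : ∀ x → (B ⟨$⟩ (h ⟨$⟩ x)) ≈ (g ⟨$⟩ (B ⟨$⟩ x))
    Bh≈gB x = ≈-trans (Func.cong B (h≈AB x)) (≈-sym (g≈BA _))

    A-^ : ∀ t x → (A ⟨$⟩ ((g ^ t) ⟨$⟩ x)) ≈ ((h ^ t) ⟨$⟩ (A ⟨$⟩ x))
    A-^ zero x = ≈-refl
    A-^ (suc t) x = ≈-trans (A-^ t (g ⟨$⟩ x)) (Func.cong (h ^ t) (Ag≈hA x))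

    B-^ : ∀ t x → (B ⟨$⟩ ((h ^ t) ⟨$⟩ x)) ≈ ((g ^ t) ⟨$⟩ (B ⟨$⟩ x))
    B-^ zero x = ≈-refl
    B-^ (suc t) x = ≈-trans (B-^ t (h ⟨$⟩ x)) (Func.cong (g ^ t) (Bh≈gB x))

    A-limit : ∀ {x} → Limit.InLimit g x → Limit.InLimit h (A ⟨$⟩ x)
    A-limit x∈ t = let y , eq = x∈ t in A ⟨$⟩ y , ≈-trans (≈-sym (A-^ t y)) (Func.cong A eq)

    -- Equal images under `A` give equal images under `g`. A positive common multiple of both
    -- periods begins with this application of `g` and then returns to the two points.
    A-injective : ∀ {x y} → Limit.InLimit g x → Limit.InLimit g y →
                  (A ⟨$⟩ x) ≈ (A ⟨$⟩ y) → x ≈ y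
    A-injective {x} {y} x∈ y∈ Ax≈Ay
      with p , x-fix ← G.limit⇒periodic enc x∈
      with q , y-fix ← G.limit⇒periodic enc y∈ = begin
        x                            ≈⟨ G.^-*-fixed (suc p) x-fix (suc q) ⟨
        (g ^ (suc q * suc p)) ⟨$⟩ x  ≈⟨ Func.cong (g ^ (p + q * suc p)) gx≈gy ⟩
        (g ^ (suc q * suc p)) ⟨$⟩ y  ≡⟨ cong (λ s → (g ^ s) ⟨$⟩ y) (*-comm (suc q) (suc p)) ⟩
        (g ^ (suc p * suc q)) ⟨$⟩ y  ≈⟨ G.^-*-fixed (suc q) y-fix (suc p) ⟩
        y                            ∎
      where
      gx≈gy : (g ⟨$⟩ x) ≈ (g ⟨$⟩ y)
      gx≈gy = ≈-trans (g≈BA x) (≈-trans (Func.cong B Ax≈Ay) (≈-sym (g≈BA y)))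

    A-surjective : ∀ {y} → Limit.InLimit h y → ∃[ x ] Limit.InLimit g x × (A ⟨$⟩ x) ≈ y
    A-surjective {y} y∈ with q , fix ← H.limit⇒periodic enc y∈ =
      x , G.periodic⇒limit (q , x-fix) ,
      ≈-trans (≈-sym (h≈AB _)) (≈-trans (≈-sym (H.^-+ 1 q y)) fix)
      where
      -- `A` takes this point to the `suc q`-th iterate of `y` under `h`, which is `y` again.
      x = B ⟨$⟩ ((h ^ q) ⟨$⟩ y)
      x-fix : ((g ^ suc q) ⟨$⟩ x) ≈ x
      x-fix = begin
        (g ^ suc q) ⟨$⟩ x                              ≈⟨ B-^ (suc q) _ ⟨
        B ⟨$⟩ ((h ^ suc q) ⟨$⟩ ((h ^ q) ⟨$⟩ y))        ≈⟨ Func.cong B (H.^-+ (suc q) q y) ⟨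
        B ⟨$⟩ ((h ^ (suc q + q)) ⟨$⟩ y)                ≡⟨ cong (λ s → B ⟨$⟩ ((h ^ s) ⟨$⟩ y)) (+-comm (suc q) q) ⟩
        B ⟨$⟩ ((h ^ (q + suc q)) ⟨$⟩ y)                ≈⟨ Func.cong B (H.^-+ q (suc q) y) ⟩
        B ⟨$⟩ ((h ^ q) ⟨$⟩ ((h ^ suc q) ⟨$⟩ y))        ≈⟨ Func.cong B (Func.cong (h ^ q) fix) ⟩
        x                                              ∎

    π : Bijection (Limit.Ω g) (Limit.Ω h)
    π = record
      { to        = λ (x , x∈) → A ⟨$⟩ x , A-limit x∈
      ; cong      = Func.cong A
      ; bijective = (λ {(x , x∈)} {(y , y∈)} → A-injective x∈ y∈)
                  , λ (y , y∈) → let x , x∈ , eq = A-surjective y∈ in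
                      (x , x∈) , λ z≈x → ≈-trans (Func.cong A z≈x) eq
      }

-- Finite configuration spaces, and modes with cyclically shifted blocks

configuration-encoding : (X : Fin n → Set) → (∀ i → ∃[ q ] (X i ↔ Fin q)) →
                         Encoding (Configuration X)
configuration-encoding {zero} X fin = 1 , (λ _ → zero) , λ _ _ _ ()
configuration-encoding {suc n} X fin
  with N , encode , injective ← configuration-encoding (X ∘ suc) (fin ∘ suc)
  with q , X₀↔ ← fin zero
  = q * N , (λ x → combine (Inverse.to X₀↔ (x zero)) (encode (x ∘ suc))) , λ x y eq → λ where
    zero    → Injection.injective (↔⇒↣ X₀↔) (Fin.combine-injectiveˡ _ _ _ _ eq)
    (suc i) → injective (x ∘ suc) (y ∘ suc)
                (Fin.combine-injectiveʳ (Inverse.to X₀↔ (x zero)) _ (Inverse.to X₀↔ (y zero)) _ eq) i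

module NetworkProperties (f : AutomataNetwork n) where
  open AutomataNetwork f
  open Setoid X using (Carrier; _≈_)

  X-encoding : Encoding X
  X-encoding = configuration-encoding Alphabet finite

  step : Carrier → Subset n → Carrier
  step x W = updateBlock W ⟨$⟩ x

  -- Folding over configurations rather than over maps turns concatenation of block lists into
  -- composition by `foldl-++`.
  updateBlocks : List (Subset n) → X ⟶ₛ X
  updateBlocks Ws = record { to = λ x → foldl step x Ws ; cong = foldl-step-cong Ws }
    where
    foldl-step-cong : ∀ Ws {x y} → x ≈ y → foldl step x Ws ≈ foldl step y Ws
    foldl-step-cong []       x≈y = x≈y
    foldl-step-cong (W ∷ Ws) x≈y = foldl-step-cong Ws (Func.cong (updateBlock W) x≈y)

  update-foldl : ∀ μ x → update μ ⟨$⟩ x ≡ foldl step x (φ μ)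
  update-foldl μ x = go _ (φ μ)
    where
    go : ∀ (g : X ⟶ₛ X) Ws → foldl (λ g W → function g (updateBlock W)) g Ws ⟨$⟩ x ≡
                             foldl step (g ⟨$⟩ x) Ws
    go g []       = refl
    go g (W ∷ Ws) = go (function g (updateBlock W)) Ws

  ++-limit-∼ : ∀ μ μ′ {Us Vs} → φ μ ≡ Us ++ Vs → φ μ′ ≡ Vs ++ Us →
               limitUpdate f μ ∼ limitUpdate f μ′
  ++-limit-∼ μ μ′ {Us} {Vs} φμ≡ φμ′≡ =
    commute-limit-∼ X-encoding (update μ) (update μ′) (updateBlocks Us) (updateBlocks Vs)
      (λ x → Setoid.reflexive X (split μ {Us} {Vs} φμ≡ x))
      (λ x → Setoid.reflexive X (split μ′ {Vs} {Us} φμ′≡ x))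
    where
    split : ∀ ν {Us Vs} → φ ν ≡ Us ++ Vs → ∀ x →
            update ν ⟨$⟩ x ≡ foldl step (foldl step x Us) Vs
    split ν {Us} {Vs} eq x =
      trans (update-foldl ν x) (trans (cong (foldl step x) eq) (foldl-++ step x Us Vs))

σ-drop-take : ∀ (i : ℤ) (xs : List A) →
              ∃[ k ] σ i xs ≡ drop k xs ++ take k xs
σ-drop-take i []         = 0 , refl
σ-drop-take i xs@(_ ∷ _) = (- i) %ℕ length xs , refl

≡⋆⇒limit-∼ : (μ μ′ : BP n) → μ ≡⋆ μ′ → ∀ f → limitUpdate f μ ∼ limitUpdate f μ′
≡⋆⇒limit-∼ μ μ′ (i , eq) f with k , σ≡ ← σ-drop-take _ (φ μ′) =
  NetworkProperties.++-limit-∼ f μ μ′ {drop k (φ μ′)} {take k (φ μ′)}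
    (trans eq σ≡) (sym (take++drop≡id k (φ μ′)))

-- Blocks and periods

%≡⇒∣ : ∀ a q m .{{_ : NonZero m}} → (a + q) % m ≡ a % m → m ∣ q
%≡⇒∣ a q m eq = ∣m+n∣m⇒∣n (divides ((a + q) / m) (+-cancelˡ-≡ (a % m) _ _ (begin
  a % m + (a / m * m + q)               ≡⟨ +-assoc (a % m) _ q ⟨
  a % m + a / m * m + q                 ≡⟨ cong (_+ q) (m≡m%n+[m/n]*n a m) ⟨
  a + q                                 ≡⟨ m≡m%n+[m/n]*n (a + q) m ⟩
  (a + q) % m + (a + q) / m * m         ≡⟨ cong (_+ (a + q) / m * m) eq ⟩
  a % m + (a + q) / m * m               ∎))) (n∣m*n (a / m))
  where open ≡.≡-Reasoning

lcm≢0 : ∀ m k → m ≢ 0 → k ≢ 0 → lcm m k ≢ 0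
lcm≢0 m k m≢0 k≢0 lcm≡0
  with m*n≡0⇒m≡0∨n≡0 m (trans (sym (gcd*lcm m k)) (trans (cong (gcd m k *_) lcm≡0) (*-zeroʳ (gcd m k))))
... | inj₁ m≡0 = m≢0 m≡0
... | inj₂ k≡0 = k≢0 k≡0

Unique-lookup-injective : {xs : List A} → Unique xs → ∀ i j →
                          List.lookup xs i ≡ List.lookup xs j → i ≡ j
Unique-lookup-injective (_ ∷ _)  zero    zero    _  = refl
Unique-lookup-injective (x∉ ∷ _) zero    (suc j) eq = contradiction eq (All.lookup x∉ (∈-lookup j))
Unique-lookup-injective (x∉ ∷ _) (suc i) zero    eq = contradiction (sym eq) (All.lookup x∉ (∈-lookup i))
Unique-lookup-injective (_ ∷ u)  (suc i) (suc j) eq = cong suc (Unique-lookup-injective u i j eq)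

toℕ-mod : ∀ m q .{{_ : NonZero q}} → toℕ (m mod q) ≡ m % q
toℕ-mod m q = Fin.toℕ-fromℕ< (m%n<n m q)

mod-cong : ∀ m k q .{{_ : NonZero q}} → m % q ≡ k % q → m mod q ≡ k mod q
mod-cong m k q eq = Fin.toℕ-injective (trans (toℕ-mod _ q) (trans eq (sym (toℕ-mod _ q))))

entry-+ : (S : List⁺ (Fin n)) → ∀ ℓ {q} → List⁺.length S ∣ q → entry S (ℓ + q) ≡ entry S ℓ
entry-+ S ℓ |S|∣q = cong (List.lookup (toList S)) (mod-cong (ℓ + _) ℓ (List⁺.length S) (%-remove-+ʳ ℓ |S|∣q))

entry-∈ : (S : List⁺ (Fin n)) → ∀ ℓ → entry S ℓ ∈ toList S
entry-∈ S ℓ = ∈-lookup (ℓ mod List⁺.length S)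

∈⇒entry : ∀ {i} (S : List⁺ (Fin n)) → i ∈ toList S → ∃[ ℓ ] i ≡ entry S ℓ
∈⇒entry S i∈S = toℕ k , trans (lookup-index i∈S) (cong (List.lookup (toList S)) (Fin.toℕ-injective (sym
  (trans (toℕ-mod (toℕ k) (List⁺.length S)) (m<n⇒m%n≡m (Fin.toℕ<n k))))))
  where k = Any.index i∈S

∈-⋃⁺ : ∀ {i : Fin n} {ps} → Any (i ∈ˢ_) ps → i ∈ˢ ⋃ ps
∈-⋃⁺ (here i∈p)  = Subset.x∈p∪q⁺ (inj₁ i∈p)
∈-⋃⁺ (there i∈⋃) = Subset.x∈p∪q⁺ (inj₂ (∈-⋃⁺ i∈⋃))

∈-⋃⁻ : ∀ {i : Fin n} ps → i ∈ˢ ⋃ ps → Any (i ∈ˢ_) ps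
∈-⋃⁻ []       i∈ = contradiction i∈ Subset.∉⊥
∈-⋃⁻ (p ∷ ps) i∈ with Subset.x∈p∪q⁻ p (⋃ ps) i∈
... | inj₁ i∈p  = here i∈p
... | inj₂ i∈ps = there (∈-⋃⁻ ps i∈ps)

lcmLength : List (List⁺ (Fin n)) → ℕ
lcmLength Ss = foldr lcm 1 (map List⁺.length Ss)

module _ (μ : BP n) where
  open BP μ

  entry-∈-block : ∀ {S} → S ∈ sequences → ∀ ℓ → entry S ℓ ∈ˢ block μ ℓ
  entry-∈-block S∈ ℓ = ∈-⋃⁺ (map⁺ (Any.map (λ where refl → Subset.x∈⁅x⁆ _) S∈))

  ∈-block⁻ : ∀ {i} ℓ → i ∈ˢ block μ ℓ → ∃[ S ] S ∈ sequences × i ≡ entry S ℓ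
  ∈-block⁻ ℓ i∈ with S , S∈ , i∈⁅⁆ ← find (map⁻ (∈-⋃⁻ _ i∈)) = S , S∈ , Subset.x∈⁅y⁆⇒x≡y _ i∈⁅⁆

  sequence-unique : ∀ {S T i} → S ∈ sequences → T ∈ sequences →
                    i ∈ toList S → i ∈ toList T → S ≡ T
  sequence-unique S∈ T∈ i∈S i∈T with ∈-AllPairs₂ disjoint S∈ T∈
  ... | inj₁ S≡T        = S≡T
  ... | inj₂ (inj₁ S#T) = contradiction (i∈S , i∈T) S#T
  ... | inj₂ (inj₂ T#S) = contradiction (i∈T , i∈S) T#S

  -- By disjointness, only the sequence that contains `i` can have placed it in the block.
  entry-unique : ∀ {S i} ℓ → S ∈ sequences → i ∈ toList S → i ∈ˢ block μ ℓ → i ≡ entry S ℓ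
  entry-unique ℓ S∈ i∈S i∈W with T , T∈ , refl ← ∈-block⁻ ℓ i∈W =
    cong (λ U → entry U ℓ) (sequence-unique T∈ S∈ (entry-∈ T ℓ) i∈S)

  length∣period : ∀ {S} → S ∈ sequences → List⁺.length S ∣ period μ
  length∣period = go sequences
    where
    go : ∀ Ss {S} → S ∈ Ss → List⁺.length S ∣ lcmLength Ss
    go (S ∷ Ss) (here refl) = m∣lcm[m,n] (List⁺.length S) (lcmLength Ss)
    go (S ∷ Ss) (there S∈)  = ∣-trans (go Ss S∈) (n∣lcm[m,n] (List⁺.length S) (lcmLength Ss))

  period-least : ∀ {q} → (∀ {S} → S ∈ sequences → List⁺.length S ∣ q) → period μ ∣ q
  period-least = go sequences
    where
    go : ∀ Ss {q} → (∀ {S} → S ∈ Ss → List⁺.length S ∣ q) → lcmLength Ss ∣ q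
    go []       _   = 1∣ _
    go (S ∷ Ss) all = lcm-least {List⁺.length S} {lcmLength Ss} (all (here refl)) (go Ss (all ∘ there))

  period≢0 : period μ ≢ 0
  period≢0 = go sequences
    where
    go : ∀ Ss → lcmLength Ss ≢ 0
    go (S ∷ Ss) = lcm≢0 (List⁺.length S) (lcmLength Ss) (λ ()) (go Ss)

  block-+ : ∀ ℓ {q} → period μ ∣ q → block μ (ℓ + q) ≡ block μ ℓ
  block-+ ℓ p∣q = cong ⋃ (map-cong-local (All.tabulate λ S∈ →
    cong ⁅_⁆ (entry-+ _ ℓ (∣-trans (length∣period S∈) p∣q))))

  -- One coincidence of blocks suffices: a block has a single entry from each sequence, and as
  -- entries are distinct it fixes the position modulo the length. Hence every length divides `q`.
  block-+⁻ : ∀ ℓ q → block μ (ℓ + q) ≡ block μ ℓ → period μ ∣ q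
  block-+⁻ ℓ q eq = period-least λ {S} S∈ →
    let e∈ = subst (entry S (ℓ + q) ∈ˢ_) eq (entry-∈-block S∈ (ℓ + q))
        mod≡ = Unique-lookup-injective (All.lookup distinct S∈) _ _
                 (entry-unique ℓ S∈ (entry-∈ S (ℓ + q)) e∈)
        m = List⁺.length S
    in %≡⇒∣ ℓ q m (trans (sym (toℕ-mod (ℓ + q) m)) (trans (cong toℕ mod≡) (toℕ-mod ℓ m)))

-- Cyclic shifts of periodic sequences

applyUpTo-+ : ∀ (f : ℕ → A) k d → applyUpTo f (k + d) ≡ applyUpTo f k ++ applyUpTo (f ∘ (k +_)) d
applyUpTo-+ f zero    d = refl
applyUpTo-+ f (suc k) d = cong (f 0 ∷_) (applyUpTo-+ (f ∘ suc) k d)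

applyUpTo-cong : ∀ {f g : ℕ → A} → (∀ i → f i ≡ g i) → ∀ k → applyUpTo f k ≡ applyUpTo g k
applyUpTo-cong f≗g zero    = refl
applyUpTo-cong f≗g (suc k) = cong₂ _∷_ (f≗g 0) (applyUpTo-cong (f≗g ∘ suc) k)

take-length-++ : ∀ (xs ys : List A) {k} → length xs ≡ k → take k (xs ++ ys) ≡ xs
take-length-++ []       ys refl = refl
take-length-++ (x ∷ xs) ys refl = cong (x ∷_) (take-length-++ xs ys refl)

drop-length-++ : ∀ (xs ys : List A) {k} → length xs ≡ k → drop k (xs ++ ys) ≡ ys
drop-length-++ []       ys refl = refl
drop-length-++ (x ∷ xs) ys refl = drop-length-++ xs ys refl

-- By periodicity, the first `k` terms moved to the end are the terms that come after the first
-- `k + d`.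
rotate-applyUpTo : ∀ (f : ℕ → A) k d → (∀ i → f (i + (k + d)) ≡ f i) →
  drop k (applyUpTo f (k + d)) ++ take k (applyUpTo f (k + d)) ≡ applyUpTo (f ∘ (k +_)) (k + d)
rotate-applyUpTo f k d f-periodic
  rewrite applyUpTo-+ f k d
        | take-length-++ (applyUpTo f k) (applyUpTo (f ∘ (k +_)) d) (length-applyUpTo f k)
        | drop-length-++ (applyUpTo f k) (applyUpTo (f ∘ (k +_)) d) (length-applyUpTo f k) = begin
  applyUpTo (f ∘ (k +_)) d ++ applyUpTo f k ≡⟨ cong (applyUpTo (f ∘ (k +_)) d ++_) (applyUpTo-cong wrap k) ⟩
  applyUpTo (f ∘ (k +_)) d ++ applyUpTo (f ∘ (k +_) ∘ (d +_)) k ≡⟨ applyUpTo-+ (f ∘ (k +_)) d k ⟨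
  applyUpTo (f ∘ (k +_)) (d + k) ≡⟨ cong (applyUpTo (f ∘ (k +_))) (+-comm d k) ⟩
  applyUpTo (f ∘ (k +_)) (k + d) ∎
  where
  open ≡.≡-Reasoning
  wrap : ∀ i → f i ≡ f (k + (d + i))
  wrap i = trans (sym (f-periodic i)) (cong f (trans (+-comm i (k + d)) (+-assoc k d i)))

drop-take-σ : ∀ (xs : List A) {k} → k < length xs →
              ∃[ i ] σ (ℤ.+ toℕ {length xs} i) xs ≡ drop k xs ++ take k xs
-- The argument of `σ` is an index below the length, so dropping nothing needs index 0, while
-- dropping a positive number needs the length minus that number.
drop-take-σ xs@(_ ∷ _) {zero}  k<  = zero , refl
drop-take-σ xs@(_ ∷ ys) {suc k} (s≤s k<) = suc (fromℕ< r<) ,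
  cong (λ j → drop j xs ++ take j xs) (begin
    - (ℤ.+ suc (toℕ (fromℕ< r<))) %ℕ length xs ≡⟨ cong (λ j → - (ℤ.+ suc j) %ℕ length xs) (Fin.toℕ-fromℕ< r<) ⟩
    -[1+ r ] %ℕ length xs                    ≡⟨ -%ℕ (s≤s r<) ⟩
    length xs ∸ suc r                        ≡⟨ m∸[m∸n]≡n k< ⟩
    suc k                                    ∎)
  where
  open ≡.≡-Reasoning
  r = length ys ∸ suc k
  r< : r < length ys
  r< = ∸-monoʳ-< z<s k<
  -%ℕ : ∀ {j p} .{{_ : NonZero p}} → suc j < p → -[1+ j ] %ℕ p ≡ p ∸ suc j
  -- The remainder of a negative integer is defined by cases on this one, which is `suc j` here.
  -%ℕ {j} {p} j<p with suc j % p | m<n⇒m%n≡m j<p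
  ... | _ | refl = refl

-- Each period is also one of the other block sequence, so by `block-+⁻` they divide each other. The
-- shift by `a` is then inverted modulo the common period, since `_≡⋆_` presents `φ μ` as a shift of
-- `φ μ′`.
shifted-blocks⇒≡⋆ : (μ μ′ : BP n) (a : ℕ) → (∀ j → block μ′ j ≡ block μ (a + j)) → μ ≡⋆ μ′
shifted-blocks⇒≡⋆ μ μ′ a shifted =
  let i , σ≡ = drop-take-σ (φ μ′) (subst (k <_) (sym (length-φ μ′)) k<p′) in
  i , (begin
    φ μ                                                  ≡⟨ map-upTo (block μ) p ⟩
    applyUpTo (block μ) p                                ≡⟨ applyUpTo-cong block-μ p ⟩
    applyUpTo (block μ′ ∘ (k +_)) p                      ≡⟨ cong (applyUpTo (block μ′ ∘ (k +_))) p≡k+d ⟩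
    applyUpTo (block μ′ ∘ (k +_)) (k + d)                ≡⟨ rotate-applyUpTo (block μ′) k d
                                                              (λ j → block-+ μ′ j (∣-reflexive p′≡k+d)) ⟨
    rotate (applyUpTo (block μ′) (k + d))                ≡⟨ cong (rotate ∘ applyUpTo (block μ′)) p′≡k+d ⟨
    rotate (applyUpTo (block μ′) p′)                     ≡⟨ cong rotate (map-upTo (block μ′) p′) ⟨
    rotate (φ μ′)                                        ≡⟨ σ≡ ⟨
    σ (ℤ.+ toℕ i) (φ μ′)                                 ∎)
  where
  open ≡.≡-Reasoning
  p  = period μ
  p′ = period μ′

  instance
    p≢0 : NonZero p
    p≢0 = ≢-nonZero (period≢0 μ)
    p′≢0 : NonZero p′
    p′≢0 = ≢-nonZero (period≢0 μ′)

  length-φ : ∀ (ν : BP _) → length (φ ν) ≡ period ν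
  length-φ ν = trans (length-map (block ν) (upTo (period ν))) (length-upTo (period ν))

  p≡p′ : p ≡ p′
  p≡p′ = ∣-antisym
    (block-+⁻ μ (a + 0) p′ (begin
      block μ (a + 0 + p′)   ≡⟨ cong (block μ) (+-assoc a 0 p′) ⟩
      block μ (a + p′)       ≡⟨ shifted p′ ⟨
      block μ′ p′            ≡⟨ block-+ μ′ 0 ∣-refl ⟩
      block μ′ 0             ≡⟨ shifted 0 ⟩
      block μ (a + 0)        ∎))
    (block-+⁻ μ′ 0 p (begin
      block μ′ p             ≡⟨ shifted p ⟩
      block μ (a + p)        ≡⟨ block-+ μ a ∣-refl ⟩
      block μ a              ≡⟨ cong (block μ) (+-identityʳ a) ⟨
      block μ (a + 0)        ≡⟨ shifted 0 ⟨
      block μ′ 0             ∎))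

  -- b ≡ - a modulo the period.
  b = a * pred p
  k = b % p′
  k<p′ : k < p′
  k<p′ = m%n<n b p′
  d = p′ ∸ k
  p′≡k+d : p′ ≡ k + d
  p′≡k+d = sym (m+[n∸m]≡n (<⇒≤ k<p′))
  p≡k+d : p ≡ k + d
  p≡k+d = trans p≡p′ p′≡k+d

  rotate : List (Subset _) → List (Subset _)
  rotate xs = drop k xs ++ take k xs

  a+b≡a*p : a + b ≡ a * p
  a+b≡a*p = trans (sym (*-suc a (pred p))) (cong (a *_) (suc-pred p))

  block-μ : ∀ j → block μ j ≡ block μ′ (k + j)
  block-μ j = begin
    block μ j                            ≡⟨ block-+ μ j (n∣m*n a) ⟨
    block μ (j + a * p)                  ≡⟨ cong (block μ) (+-comm j (a * p)) ⟩
    block μ (a * p + j)                  ≡⟨ cong (λ r → block μ (r + j)) a+b≡a*p ⟨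
    block μ (a + b + j)                  ≡⟨ cong (block μ) (+-assoc a b j) ⟩
    block μ (a + (b + j))                ≡⟨ shifted (b + j) ⟨
    block μ′ (b + j)                     ≡⟨ cong (λ r → block μ′ (r + j)) (m≡m%n+[m/n]*n b p′) ⟩
    block μ′ (k + e + j)                 ≡⟨ cong (block μ′) (+-assoc k e j) ⟩
    block μ′ (k + (e + j))               ≡⟨ cong (λ r → block μ′ (k + r)) (+-comm e j) ⟩
    block μ′ (k + (j + e))               ≡⟨ cong (block μ′) (+-assoc k j e) ⟨
    block μ′ (k + j + e)                 ≡⟨ block-+ μ′ (k + j) (n∣m*n (b / p′)) ⟩
    block μ′ (k + j)                     ∎
    where e = b / p′ * p′

-- Sums modulo m

%-congˡ-+ : ∀ a b c m .{{_ : NonZero m}} → a % m ≡ b % m → (a + c) % m ≡ (b + c) % m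
%-congˡ-+ a b c m eq =
  trans (%-distribˡ-+ a c m) (trans (cong (λ r → (r + c % m) % m) eq) (sym (%-distribˡ-+ b c m)))

%-congʳ-+ : ∀ a b c m .{{_ : NonZero m}} → a % m ≡ b % m → (c + a) % m ≡ (c + b) % m
%-congʳ-+ a b c m eq =
  trans (cong (_% m) (+-comm c a)) (trans (%-congˡ-+ a b c m eq) (cong (_% m) (+-comm b c)))

module _ {m : ℕ} .{{_ : NonZero m}} (g h : A → ℕ) where

  sum-increment-% : ∀ {e xs} → Unique xs → e ∈ xs →
                    (∀ {i} → i ∈ xs → i ≢ e → h i ≡ g i) → h e % m ≡ suc (g e) % m →
                    sum (map h xs) % m ≡ suc (sum (map g xs)) % m
  sum-increment-% {e} {_ ∷ xs} (e∉ ∷ _) (here refl) same inc = begin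
    (h e + sum (map h xs)) % m       ≡⟨ cong (λ l → (h e + sum l) % m) (map-cong-local (All.tabulate λ i∈ →
                                          same (there i∈) (All.lookup e∉ i∈ ∘ sym))) ⟩
    (h e + sum (map g xs)) % m       ≡⟨ %-congˡ-+ (h e) (suc (g e)) (sum (map g xs)) m inc ⟩
    suc (g e + sum (map g xs)) % m   ∎
    where open ≡.≡-Reasoning
  sum-increment-% {e} {x ∷ xs} (x∉ ∷ u) (there e∈) same inc = begin
    (h x + sum (map h xs)) % m       ≡⟨ cong (λ v → (v + sum (map h xs)) % m) (same (here refl) (All.lookup x∉ e∈)) ⟩
    (g x + sum (map h xs)) % m       ≡⟨ %-congʳ-+ (sum (map h xs)) (suc (sum (map g xs))) (g x) m
                                          (sum-increment-% u e∈ (same ∘ there) inc) ⟩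
    (g x + suc (sum (map g xs))) % m ≡⟨ cong (_% m) (+-suc (g x) _) ⟩
    suc (g x + sum (map g xs)) % m   ∎
    where open ≡.≡-Reasoning

-- The given element guarantees that there is a sequence at all. Nonempty blocks make errors persist
-- and make the clock advance at every step.
block-nonempty : (μ : BP n) → Fin n → ∀ ℓ → ∃[ i ] i ∈ˢ block μ ℓ
block-nonempty μ i₀ ℓ with S , S∈ , _ ← find (BP.covering μ i₀) = entry S ℓ , entry-∈-block μ S∈ ℓ

-- Runs along infinite block sequences

module Runs (f : AutomataNetwork n) where
  open AutomataNetwork f
  open Setoid X using (Carrier)
  open NetworkProperties f
  open Endo X using (_^_)

  run : (ℕ → Subset n) → Carrier → ℕ → Carrier
  run W x zero    = x
  run W x (suc j) = step (run W x j) (W j)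

  foldl-run : ∀ W x p → foldl step x (applyUpTo W p) ≡ run W x p
  foldl-run W x zero    = refl
  foldl-run W x (suc p) = begin
    foldl step x (applyUpTo W (suc p))       ≡⟨ cong (foldl step x) (applyUpTo-∷ʳ W p) ⟨
    foldl step x (applyUpTo W p List.∷ʳ W p) ≡⟨ foldl-∷ʳ step x (W p) (applyUpTo W p) ⟩
    step (foldl step x (applyUpTo W p)) (W p) ≡⟨ cong (λ y → step y (W p)) (foldl-run W x p) ⟩
    run W x (suc p)                          ∎
    where open ≡.≡-Reasoning

  run-+ : ∀ {W p} → (∀ j → W (j + p) ≡ W j) → ∀ x i → run W x (i + p) ≡ run W (run W x p) i
  run-+ periodic x zero    = refl
  run-+ periodic x (suc i) = cong₂ step (run-+ periodic x i) (periodic i)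

  update-run : ∀ μ x → update μ ⟨$⟩ x ≡ run (block μ) x (period μ)
  update-run μ x = trans (update-foldl μ x)
    (trans (cong (foldl step x) (map-upTo (block μ) (period μ))) (foldl-run (block μ) x (period μ)))

  update^-run : ∀ μ t x → (update μ ^ t) ⟨$⟩ x ≡ run (block μ) x (t * period μ)
  update^-run μ zero    x = refl
  update^-run μ (suc t) x = begin
    (update μ ^ t) ⟨$⟩ (update μ ⟨$⟩ x)               ≡⟨ update^-run μ t _ ⟩
    run W (update μ ⟨$⟩ x) (t * p)                   ≡⟨ cong (λ y → run W y (t * p)) (update-run μ x) ⟩
    run W (run W x p) (t * p)                        ≡⟨ run-+ (λ j → block-+ μ j ∣-refl) x (t * p) ⟨
    run W x (t * p + p)                              ≡⟨ cong (run W x) (+-comm (t * p) p) ⟩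
    run W x (p + t * p)                              ∎
    where
    open ≡.≡-Reasoning
    W = block μ
    p = period μ

-- The network of a mode

-- M = suc (suc m) because the clock does not move modulo 1.
module ClockNetwork (μ : BP n) (i₀ : Fin n) (m : ℕ) (p∣M : period μ ∣ suc (suc m)) where
  open BP μ

  M : ℕ
  M = suc (suc m)

  -- zero is the error letter; suc v is the counter value v modulo M.
  value : Fin (suc M) → ℕ
  value = pred ∘ toℕ

  -- The error letter counts as value 0 here; `rule` applies `next` only in good configurations,
  -- where that letter is absent.
  next : Fin (suc M) → Fin (suc M)
  next v = suc (suc (value v) mod M)

  value-next : ∀ v → value (next v) ≡ suc (value v) % M
  value-next v = toℕ-mod (suc (value v)) M

  suc-% : ∀ t → suc (t % M) % M ≡ suc t % M
  suc-% t = %-congʳ-+ (t % M) t 1 M (m%n%n≡m%n t M)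

  Config : Set
  Config = Fin n → Fin (suc M)

  tally : Config → List⁺ (Fin n) → ℕ
  tally x S = sum (map (value ∘ x) (toList S)) % M

  -- A reference sequence for reading the time; in a good configuration every sequence shows the
  -- same.
  S₀ : List⁺ (Fin n)
  S₀ = proj₁ (find (covering i₀))

  S₀∈ : S₀ ∈ sequences
  S₀∈ = proj₁ (proj₂ (find (covering i₀)))

  clock : Config → ℕ
  clock x = tally x S₀

  Good : Config → Set
  Good x = (∀ i → x i ≢ zero) × All (λ S → tally x S ≡ clock x) sequences

  good? : ∀ x → Dec (Good x)
  good? x = Fin.all? (λ i → ¬? (x i Fin.≟ zero)) ×-dec All.all? (λ S → tally x S ≟ clock x) sequences

  Enabled : Config → Fin n → Set
  Enabled x i = Good x × i ∈ˢ block μ (clock x)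

  enabled? : ∀ x i → Dec (Enabled x i)
  enabled? x i = good? x ×-dec (i Subset.∈? block μ (clock x))

  rule : Config → Config
  rule x i = if does (enabled? x i) then next (x i) else zero

  rule-enabled : ∀ {x i} → Enabled x i → rule x i ≡ next (x i)
  rule-enabled {x} {i} e = cong (if_then next (x i) else zero) (dec-true (enabled? x i) e)

  rule-disabled : ∀ {x i} → ¬ Enabled x i → rule x i ≡ zero
  rule-disabled {x} {i} ¬e = cong (if_then next (x i) else zero) (dec-false (enabled? x i) ¬e)

  tally-cong : ∀ {x y} → x ≗ y → ∀ S → tally x S ≡ tally y S
  tally-cong x≗y S = cong (λ l → sum l % M) (map-cong (cong value ∘ x≗y) (toList S))

  Good-resp : ∀ {x y} → x ≗ y → Good x → Good y
  Good-resp x≗y (nz , all) = (λ i → nz i ∘ trans (x≗y i)) ,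
    All.map (λ {S} eq → trans (sym (tally-cong x≗y S)) (trans eq (tally-cong x≗y S₀))) all

  Enabled-resp : ∀ {x y} → x ≗ y → ∀ {i} → Enabled x i → Enabled y i
  Enabled-resp x≗y {i} (good , i∈) = Good-resp x≗y good ,
    subst (λ t → i ∈ˢ block μ t) (tally-cong x≗y S₀) i∈

  rule-cong : ∀ {x y} → x ≗ y → rule x ≗ rule y
  rule-cong {x} {y} x≗y i with enabled? x i | enabled? y i
  ... | yes e | yes e′ = trans (rule-enabled e) (trans (cong next (x≗y i)) (sym (rule-enabled e′)))
  ... | no ¬e | no ¬e′ = trans (rule-disabled ¬e) (sym (rule-disabled ¬e′))
  ... | yes e | no  ¬e = contradiction (Enabled-resp x≗y e) ¬e
  ... | no ¬e | yes e  = contradiction (Enabled-resp (sym ∘ x≗y) e) ¬e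

  network : AutomataNetwork n
  network = record
    { Alphabet   = λ _ → Fin (suc M)
    ; finite     = λ _ → suc M , ↔-id _
    ; nonempty   = λ _ → zero
    ; transition = record { to = rule ; cong = rule-cong }
    }

  open AutomataNetwork network using (update)
  open NetworkProperties network using (step; X-encoding)
  open Runs network

  -- A single block update of the clock network

  step-∈ : ∀ x {W i} → i ∈ˢ W → step x W i ≡ rule x i
  step-∈ x {W} {i} i∈W = cong (if_then rule x i else x i) (dec-true (i Subset.∈? W) i∈W)

  step-∉ : ∀ x {W i} → i ∉ˢ W → step x W i ≡ x i
  step-∉ x {W} {i} i∉W = cong (if_then rule x i else x i) (dec-false (i Subset.∈? W) i∉W)

  step-bad-∈ : ∀ {x W i} → ¬ Good x → i ∈ˢ W → step x W i ≡ zero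
  step-bad-∈ {x} bad i∈W = trans (step-∈ x i∈W) (rule-disabled (bad ∘ proj₁))

  step-bad-zero : ∀ {x W i} → ¬ Good x → x i ≡ zero → step x W i ≡ zero
  step-bad-zero {x} {W} {i} bad xi≡0 with i Subset.∈? W
  ... | yes i∈W = rule-disabled (bad ∘ proj₁)
  ... | no  i∉W = xi≡0

  step-bad : ∀ {x W} → ¬ Good x → ∃[ i ] i ∈ˢ W → ¬ Good (step x W)
  step-bad bad (i , i∈W) (nz , _) = nz i (step-bad-∈ bad i∈W)

  module _ {x W} (good : Good x) (W⊆ : W ⊆ˢ block μ (clock x)) where

    value-step-∈ : ∀ {i} → i ∈ˢ W → value (step x W i) ≡ suc (value (x i)) % M
    value-step-∈ {i} i∈W =
      trans (cong value (trans (step-∈ x i∈W) (rule-enabled (good , W⊆ i∈W)))) (value-next (x i))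

    -- Inside `S`, only the expected entry can belong to `W`, so exactly one counter advances.
    tally-step-∈ : ∀ {S} → S ∈ sequences → entry S (clock x) ∈ˢ W →
                   tally (step x W) S ≡ suc (clock x) % M
    tally-step-∈ {S} S∈ e∈W = begin
      tally (step x W) S                                ≡⟨ sum-increment-% (value ∘ x) (value ∘ step x W)
                                                             (All.lookup distinct S∈) (entry-∈ S (clock x)) unchanged incremented ⟩
      suc (sum (map (value ∘ x) (toList S))) % M        ≡⟨ suc-% (sum (map (value ∘ x) (toList S))) ⟨
      suc (tally x S) % M                               ≡⟨ cong (λ t → suc t % M) (All.lookup (proj₂ good) S∈) ⟩
      suc (clock x) % M                                 ∎
      where
      open ≡.≡-Reasoning
      unchanged : ∀ {i} → i ∈ toList S → i ≢ entry S (clock x) → value (step x W i) ≡ value (x i)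
      unchanged i∈S i≢e = cong value (step-∉ x λ i∈W → i≢e (entry-unique μ (clock x) S∈ i∈S (W⊆ i∈W)))
      incremented : value (step x W (entry S (clock x))) % M ≡ suc (value (x (entry S (clock x)))) % M
      incremented = trans (cong (_% M) (value-step-∈ e∈W)) (m%n%n≡m%n (suc (value (x (entry S (clock x))))) M)

    tally-step-∉ : ∀ {S} → S ∈ sequences → entry S (clock x) ∉ˢ W → tally (step x W) S ≡ clock x
    tally-step-∉ {S} S∈ e∉W = trans
      (cong (λ l → sum l % M) (map-cong-local (All.tabulate λ {i} i∈S → cong value (step-∉ x λ i∈W →
        e∉W (subst (_∈ˢ W) (entry-unique μ (clock x) S∈ i∈S (W⊆ i∈W)) i∈W)))))
      (All.lookup (proj₂ good) S∈)

  -- A stationary clock would make `M` divide 1.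
  clock-moves : ∀ x → suc (clock x) % M ≢ clock x
  clock-moves x eq = contradiction (∣1⇒≡1 (%≡⇒∣ t 1 M (begin
    (t + 1) % M      ≡⟨ cong (_% M) (+-comm t 1) ⟩
    suc t % M        ≡⟨ suc-% t ⟨
    suc (t % M) % M  ≡⟨ eq ⟩
    t % M            ∎))) λ ()
    where
    open ≡.≡-Reasoning
    t = sum (map (value ∘ x) (toList S₀))

  step-good⁺ : ∀ {x} → Good x → let y = step x (block μ (clock x)) in
               Good y × clock y ≡ suc (clock x) % M
  step-good⁺ {x} good = (nonzero , All.tabulate λ S∈ → trans (tick S∈) (sym (tick S₀∈))) , tick S₀∈
    where
    W = block μ (clock x)
    tick : ∀ {S} → S ∈ sequences → tally (step x W) S ≡ suc (clock x) % M
    tick S∈ = tally-step-∈ good id S∈ (entry-∈-block μ S∈ (clock x))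
    nonzero : ∀ i → step x W i ≢ zero
    nonzero i = [ (λ i∈W eq → contradiction
                    (trans (sym (trans (step-∈ x i∈W) (rule-enabled (good , i∈W)))) eq) λ ())
                , (λ i∉W eq → proj₁ good i (trans (sym (step-∉ x i∉W)) eq))
                ]′ (toSum (i Subset.∈? W))

  -- Goodness afterwards means that no error was written, so `W` has no unexpected element. None is
  -- missing either: a sequence skipped by `W` would keep its old tally while the clock has moved.
  step-good⁻ : ∀ {x W} → ∃[ i ] i ∈ˢ W → Good x → Good (step x W) →
               W ≡ block μ (clock x) × clock (step x W) ≡ suc (clock x) % M
  step-good⁻ {x} {W} (j , j∈W) good good′ = Subset.⊆-antisym W⊆ ⊆W , tick
    where
    W⊆ : W ⊆ˢ block μ (clock x)
    W⊆ {i} i∈W = decidable-stable (i Subset.∈? block μ (clock x)) λ i∉ →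
      proj₁ good′ i (trans (step-∈ x i∈W) (rule-disabled (i∉ ∘ proj₂)))
    tick : clock (step x W) ≡ suc (clock x) % M
    -- The sequence of `j` may differ from `S₀`; equality of tallies afterwards transfers its
    -- increment to the clock.
    tick with S , S∈ , refl ← ∈-block⁻ μ (clock x) (W⊆ j∈W) =
      trans (sym (All.lookup (proj₂ good′) S∈)) (tally-step-∈ good W⊆ S∈ j∈W)
    ⊆W : block μ (clock x) ⊆ˢ W
    ⊆W {i} i∈ with S , S∈ , refl ← ∈-block⁻ μ (clock x) i∈ =
      decidable-stable (i Subset.∈? W) λ i∉W → clock-moves x
        (trans (sym tick) (trans (sym (All.lookup (proj₂ good′) S∈)) (tally-step-∉ good W⊆ S∈ i∉W)))

  -- Limit configurations of the clock network

  start : Config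
  start _ = suc zero

  error : Config
  error _ = zero

  tally-start : ∀ S → tally start S ≡ 0
  tally-start S = cong (_% M) (go (toList S))
    where
    go : ∀ xs → sum (map (value ∘ start) xs) ≡ 0
    go []       = refl
    go (_ ∷ xs) = go xs

  block-% : ∀ t → block μ (t % M) ≡ block μ t
  block-% t = trans (sym (block-+ μ (t % M) (∣n⇒∣m*n (t / M) p∣M)))
    (cong (block μ) (sym (m≡m%n+[m/n]*n t M)))

  -- Since the period of `μ` divides `M`, the block that `μ` applies is always the one indicated by
  -- the clock.
  run-start : ∀ j → Good (run (block μ) start j) × clock (run (block μ) start j) ≡ j % M
  run-start zero =
    ((λ _ ()) , All.tabulate λ {S} _ → trans (tally-start S) (sym (tally-start S₀))) , tally-start S₀
  run-start (suc j) with good , clock≡ ← run-start j =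
    subst (λ W → Good (step y W) × clock (step y W) ≡ suc j % M)
      (trans (cong (block μ) clock≡) (block-% j))
      (let good′ , clock′ = step-good⁺ good in
       good′ , trans clock′ (trans (cong (λ t → suc t % M) clock≡) (suc-% j)))
    where y = run (block μ) start j

  error-bad : ¬ Good error
  error-bad (nz , _) = nz i₀ refl

  run-bad : ∀ {W} → (∀ j → ∃[ i ] i ∈ˢ W j) → ∀ x j → ¬ Good (run W x j) →
            ∀ d → ¬ Good (run W x (d + j))
  run-bad ne x j bad zero    = bad
  run-bad ne x j bad (suc d) = step-bad (run-bad ne x j bad d) (ne _)

  -- Badness persists by `run-bad`, and in a bad configuration an automaton in error either rewrites
  -- the error letter or keeps it.
  run-error : ∀ {W} → (∀ j → ∃[ i ] i ∈ˢ W j) → ∀ x i j → ¬ Good (run W x j) →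
              run W x j i ≡ zero → ∀ d → run W x (d + j) i ≡ zero
  run-error ne x i j bad eq zero = eq
  run-error {W} ne x i j bad eq (suc d) =
    step-bad-zero {run W x (d + j)} {W (d + j)} {i} (run-bad ne x j bad d) (run-error ne x i j bad eq d)

  module _ (μ′ : BP n) where
    open LimitProperties (update μ′)
    private
      W′ = block μ′
      nonempty′ = block-nonempty μ′ i₀

    error-periodic : IsPeriodic error
    -- The witness 0 encodes period 1: `error` is a fixed point.
    error-periodic = 0 , λ i → trans (cong (λ x → x i) (update-run μ′ error))
      (subst (λ j → run W′ error j i ≡ zero) (+-identityʳ (period μ′))
        (run-error nonempty′ error i 0 error-bad refl (period μ′)))

    -- Every automaton is updated at some time after the run has become bad and is in error from
    -- then on; periodicity carries this back to `x`.
    periodic-bad⇒error : ∀ {x j} → IsPeriodic x → ¬ Good (run W′ x j) → x ≗ error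
    periodic-bad⇒error {x} {j} (q , fix) bad i
      with S , S∈ , i∈S ← find (BP.covering μ′ i)
      with ℓ , i≡ ← ∈⇒entry S i∈S = begin
        x i                                       ≡⟨ ^-*-fixed (suc q) fix (suc t) i ⟨
        ((update μ′ ^ r) ⟨$⟩ x) i                 ≡⟨ cong (λ y → y i) (update^-run μ′ r x) ⟩
        run W′ x (r * period μ′) i                ≡⟨ cong (λ k → run W′ x k i) (m∸n+n≡m t<) ⟨
        run W′ x (r * period μ′ ∸ suc t + suc t) i ≡⟨ run-error nonempty′ x i (suc t) (step-bad bad-t (nonempty′ t))
                                                      (step-bad-∈ bad-t i∈W) (r * period μ′ ∸ suc t) ⟩
        zero                                      ∎
      where
      open ≡.≡-Reasoning
      open Endo (AutomataNetwork.X network) using (_^_)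
      instance
        p≢0 : NonZero (period μ′)
        p≢0 = ≢-nonZero (period≢0 μ′)
      -- A time no earlier than `j` and congruent to `ℓ` modulo the length of `S`, so that its block
      -- contains `i`.
      t = ℓ + j * List⁺.length S
      -- A multiple of the period of `x`, large enough for that many updates to run past time `t`.
      r = suc t * suc q
      t< : suc t ≤ r * period μ′
      t< = ≤-trans (m≤m*n (suc t) (suc q)) (m≤m*n r (period μ′))
      j≤t : j ≤ t
      j≤t = ≤-trans (m≤m*n j (List⁺.length S)) (m≤n+m _ ℓ)
      i∈W : i ∈ˢ W′ t
      i∈W = subst (_∈ˢ W′ t) (trans (entry-+ S ℓ (n∣m*n j)) (sym i≡)) (entry-∈-block μ′ S∈ t)
      bad-t : ¬ Good (run W′ x t)
      bad-t = subst (λ k → ¬ Good (run W′ x k)) (m∸n+n≡m j≤t) (run-bad nonempty′ x j bad (t ∸ j))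

    -- By `periodic-bad⇒error` the run stays good for ever. So `step-good⁻` applies at each step,
    -- and the initial clock reading is the shift between the two block sequences.
    periodic-nonerror⇒≡⋆ : ∀ {x} → IsPeriodic x → ¬ x ≗ error → μ ≡⋆ μ′
    periodic-nonerror⇒≡⋆ {x} periodic x≢error = shifted-blocks⇒≡⋆ μ μ′ (clock x) λ j → begin
      block μ′ j                     ≡⟨ proj₁ (tick j) ⟩
      block μ (clock (run W′ x j))   ≡⟨ cong (block μ) (clock-run j) ⟩
      block μ ((j + clock x) % M)    ≡⟨ block-% (j + clock x) ⟩
      block μ (j + clock x)          ≡⟨ cong (block μ) (+-comm j (clock x)) ⟩
      block μ (clock x + j)          ∎
      where
      open ≡.≡-Reasoning
      good : ∀ j → Good (run W′ x j)
      good j = decidable-stable (good? _) λ bad → x≢error (periodic-bad⇒error {x} {j} periodic bad)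
      tick : ∀ j → W′ j ≡ block μ (clock (run W′ x j)) ×
                   clock (run W′ x (suc j)) ≡ suc (clock (run W′ x j)) % M
      tick j = step-good⁻ (nonempty′ j) (good j) (good (suc j))
      clock-run : ∀ j → clock (run W′ x j) ≡ (j + clock x) % M
      clock-run zero    = sym (m%n%n≡m%n (sum (map (value ∘ x) (toList S₀))) M)
      clock-run (suc j) = trans (proj₂ (tick j))
        (trans (cong (λ t → suc t % M) (clock-run j)) (suc-% (j + clock x)))

  -- The orbit of `start` under `μ` reaches a cycle without ever leaving the good configurations.
  limit-nonerror : ∃[ x ] LimitProperties.IsPeriodic (update μ) x × ¬ x ≗ error
  limit-nonerror with i , _ , periodic ← LimitProperties.iterate-periodic (update μ) X-encoding start =
    _ , periodic , λ eq → proj₁ (proj₁ (run-start (i * period μ))) i₀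
      (trans (cong (λ y → y i₀) (sym (update^-run μ i start))) (eq i₀))

  -- Two distinct limit points under `μ` have distinct images, so one of the images is a limit point
  -- under `μ′` other than `error`.
  limit-∼⇒≡⋆ : ∀ μ′ → limitUpdate network μ ∼ limitUpdate network μ′ → μ ≡⋆ μ′
  limit-∼⇒≡⋆ μ′ (π , _)
    with x , x-periodic , x≢error ← limit-nonerror
    = from-images (to (x , G.periodic⇒limit x-periodic))
        (to (error , G.periodic⇒limit (error-periodic μ))) (x≢error ∘ injective)
    where
    open Bijection π using (to; injective)
    module G = LimitProperties (update μ)
    module H = LimitProperties (update μ′)

    from-images : (y z : ∃[ x ] Limit.InLimit (update μ′) x) → ¬ proj₁ y ≗ proj₁ z → μ ≡⋆ μ′
    from-images (y , y∈) (z , z∈) y≢z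
      with Fin.all? (λ i → y i Fin.≟ zero) | Fin.all? (λ i → z i Fin.≟ zero)
    ... | yes y≡error | yes z≡error = contradiction (λ i → trans (y≡error i) (sym (z≡error i))) y≢z
    ... | no y≢error  | _           = periodic-nonerror⇒≡⋆ μ′ (H.limit⇒periodic X-encoding y∈) y≢error
    ... | _           | no z≢error  = periodic-nonerror⇒≡⋆ μ′ (H.limit⇒periodic X-encoding z∈) z≢error

-- Supplies the modulus of the clock: the period itself, or 2 when the period is 1.
multiple≥2 : ∀ p → p ≢ 0 → ∃[ m ] p ∣ suc (suc m)
multiple≥2 zero          p≢0 = contradiction refl p≢0
multiple≥2 (suc zero)    _   = 0 , 1∣ 2
multiple≥2 (suc (suc m)) _   = m , ∣-refl

lemma4 : (n : ℕ) → 1 ≤ n → (μ μ′ : BP n) →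
    μ ≡⋆ μ′ ⇔ ((f : AutomataNetwork n) → limitUpdate f μ ∼ limitUpdate f μ′)
lemma4 (suc n) _ μ μ′ = mk⇔ (≡⋆⇒limit-∼ μ μ′) λ ∀f →
  let m , p∣M = multiple≥2 (period μ) (period≢0 μ)
  in ClockNetwork.limit-∼⇒≡⋆ μ zero m p∣M μ′ (∀f (ClockNetwork.network μ zero m p∣M))
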